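{- Let $s\ge5$ be a constant odd integer. There is a randomized distributed algorithm with 1-sided error in the CONGEST model that solves $K_s$-freeness on the family of $K_s$-Behrend graphs $BK(s,n)$ ($n$ prime) in $O(n^{o(1)})$ rounds; that is, when the network is $BK(s,n)$, within $n^{o(1)}$ rounds some node finds a copy of $K_s$ and rejects with probability at least $2/3$.
   Context: CONGEST model: the network is an undirected graph on $N$ nodes with unique $O(\log N)$-bit identifiers; computation is synchronous, and in each round every node may send $O(\log N)$ bits over each incident edge; nodes have private randomness. The nodes do not know to which set $V^i$ (below) they belong. 1-sided error means that a node rejects only if the graph contains a copy of $K_s$. Behrend graphs: let $s$ be a constant odd number and $n$ a (sufficiently large) prime. Let $X\subset\{0,\dots,n-1\}$ be a set of size at least $n/f(n)$, where $f(n)=n^{\frac{\log\log\log n+4}{\log\log n}}=n^{o(1)}$, such that for any $x_1,\dots,x_s\in X$, $\sum_{i=1}^{s-1}x_i\equiv(s-1)x_s \pmod n$ implies $x_1=\dots=x_s$ (such a set is known to exist). The graph $BK(s,n)$ has vertex set $V^1\cup\dots\cup V^s$, a disjoint union with $V^i=\{u^i_j : j\in\mathbb{Z}/n\}$; for every $x\in X$ and every $j\in\mathbb{Z}/n$, all edges of the clique on $u^1_{j},u^2_{j+x},u^3_{j+2x},\dots,u^s_{j+(s-1)x}$ (indices mod $n$) are added. -}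

module Defs where

open import Algebra.Definitions.RawSemiring using () renaming (_^_ to power)
open import Data.Bool.Base using (Bool)
open import Data.Fin.Base using (Fin; toℕ; combine; finToFun)
open import Data.Fin.Properties using (combine-injectiveˡ)
open import Data.Fin.Subset using (Subset; _∈_; ∣_∣)
open import Data.Integer.Base using (ℤ; +_; -[1+_])
open import Data.Maybe using (Maybe; just; Is-just)
open import Data.Nat.Base using (ℕ; zero; suc; _+_; _*_; _∸_; _^_; _≤_; NonZero)
open import Data.Nat.DivMod using (_%_; _mod_)
open import Data.Nat.Logarithm using (⌈log₂_⌉)
open import Data.Nat.Properties using (m^n≢0)
open import Data.Product.Base using (∃; ∃₂; _×_; _,_; proj₁)
open import Data.Rational.Unnormalised.Base as ℚ
  using (ℚᵘ; 0ℚᵘ; ↥_; ↧ₙ_; +-*-rawSemiring)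
open import Data.Sum.Base using (_⊎_)
open import Data.Vec.Base as Vec using (Vec; tabulate)
open import Data.Vec.Relation.Unary.All using (All)
open import Function.Base using (_∘_)
open import Function.Definitions using (Injective)
open import Relation.Binary.PropositionalEquality using (_≡_; _≢_; sym; trans)
open import Relation.Nullary.Negation using (¬_)

------------------------------------------------------------------------
-- Real numbers, as the sets of rationals strictly below and strictly
-- above them.  The Dedekind axioms are not carried along: only the cuts
-- produced by the operations below, on their stated domains, are used.

record ℝ : Set₁ where
  field
    below above : ℚᵘ → Set

open ℝ public

infix 4 _≤ᵣ_

_≤ᵣ_ : ℝ → ℝ → Set
x ≤ᵣ y = ∀ q → below x q → below y q

fromℕ : ℕ → ℝ
fromℕ m = record { below = ℚ._< + m ℚ./ 1 ; above = + m ℚ./ 1 ℚ.<_ }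

infixl 6 _+ᵣ_
infixl 7 _÷ᵣ_

_+ᵣ_ : ℝ → ℝ → ℝ
x +ᵣ y = record
  { below = λ q → ∃₂ λ a b → below x a × below y b × q ℚ.≤ a ℚ.+ b
  ; above = λ q → ∃₂ λ a b → above x a × above y b × a ℚ.+ b ℚ.≤ q
  }

-- Meaningful for x ≥ 0 and y > 0.
_÷ᵣ_ : ℝ → ℝ → ℝ
x ÷ᵣ y = record
  { below = λ q → ∃₂ λ a b → below x a × above y b × 0ℚᵘ ℚ.< b × q ℚ.* b ℚ.≤ a
  ; above = λ q → ∃₂ λ a b → above x a × below y b × 0ℚᵘ ℚ.< b × a ℚ.≤ q ℚ.* b
  }

_^ℤ_ : (b : ℕ) .{{_ : NonZero b}} → ℤ → ℚᵘ
b ^ℤ (+ k)    = + (b ^ k) ℚ./ 1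
b ^ℤ -[1+ k ] = (+ 1 ℚ./ (b ^ suc k)) {{m^n≢0 b (suc k)}}

-- b^e ≤ q and q ≤ b^e for a rational exponent e = c/d, stated without
-- roots as b^c ≤ q^d (for q > 0) and q^d ≤ b^c (unless q ≤ 0).
Pow≤ ≤Pow : (b : ℕ) .{{_ : NonZero b}} → ℚᵘ → ℚᵘ → Set
Pow≤ b e q = 0ℚᵘ ℚ.< q × b ^ℤ (↥ e) ℚ.≤ power +-*-rawSemiring q (↧ₙ e)
≤Pow b e q = q ℚ.≤ 0ℚᵘ ⊎ power +-*-rawSemiring q (↧ₙ e) ℚ.≤ b ^ℤ (↥ e)

-- Meaningful for x > 0.
log₂ : ℝ → ℝ
log₂ x = record
  { below = λ q → ∃ λ a → below x a × Pow≤ 2 q a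
  ; above = λ q → ∃ λ a → above x a × ≤Pow 2 q a
  }

-- Meaningful for b > 1.
_^ᵣ_ : (b : ℕ) .{{_ : NonZero b}} → ℝ → ℝ
b ^ᵣ y = record
  { below = λ q → ∃ λ e → below y e × ≤Pow b e q
  ; above = λ q → ∃ λ e → above y e × Pow≤ b e q
  }

-- f(n) = n^((log log log n + 4) / log log n), defined for n ≥ 3.
behrendLoss : (n : ℕ) .{{_ : NonZero n}} → ℝ
behrendLoss n = n ^ᵣ ((log₂ loglog +ᵣ fromℕ 4) ÷ᵣ loglog)
  where
  loglog : ℝ
  loglog = log₂ (log₂ (fromℕ n))

------------------------------------------------------------------------
-- Growth rates

-- g(n) = n^o(1): for every k ≥ 1, eventually g(n) ≤ n^(1/k).
SubPolynomial : (ℕ → ℕ) → Set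
SubPolynomial g = ∀ k → ∃ λ n₀ → ∀ n → n₀ ≤ n → g n ^ k ≤ n

IsO[n^o[1]] : (ℕ → ℕ) → Set
IsO[n^o[1]] h = ∃ λ g → SubPolynomial g ×
  ∃₂ λ C n₀ → ∀ n → n₀ ≤ n → h n ≤ C * g n

------------------------------------------------------------------------
-- Graphs

record Graph (N : ℕ) : Set₁ where
  field
    Adj     : Fin N → Fin N → Set
    Adj-sym : ∀ {v w} → Adj v w → Adj w v
    irrefl  : ∀ {v} → ¬ Adj v v

IsClique : ∀ {N s} → Graph N → (Fin s → Fin N) → Set
IsClique G c = ∀ i j → i ≢ j → Graph.Adj G (c i) (c j)

ContainsK : ∀ {N} → ℕ → Graph N → Set
ContainsK {N} s G = ∃ λ (c : Fin s → Fin N) → IsClique G c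

------------------------------------------------------------------------
-- Behrend graphs

BehrendSet : ∀ s {n} .{{_ : NonZero n}} → Subset n → Set
BehrendSet s {n} X =
  ∀ (xs : Vec (Fin n) (s ∸ 1)) (y : Fin n) → All (_∈ X) xs → y ∈ X →
  Vec.sum (Vec.map toℕ xs) % n ≡ ((s ∸ 1) * toℕ y) % n →
  All (_≡ y) xs

-- The vertex u^{i+1}_{j+ix}: parts are numbered from 0 here.
cliqueVertex : ∀ s n .{{_ : NonZero n}} → (x j : Fin n) → Fin s → Fin (s * n)
cliqueVertex s n x j i = combine i ((toℕ j + toℕ i * toℕ x) mod n)

BK : ∀ s n .{{_ : NonZero n}} → Subset n → Graph (s * n)
BK s n X = record
  { Adj     = λ v w → ∃₂ λ x j → x ∈ X × ∃₂ λ i k → i ≢ k ×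
                v ≡ cliqueVertex s n x j i × w ≡ cliqueVertex s n x j k
  ; Adj-sym = λ { (x , j , x∈X , i , k , i≢k , v≡ , w≡) →
                  x , j , x∈X , k , i , i≢k ∘ sym , w≡ , v≡ }
  ; irrefl  = λ { (x , j , x∈X , i , k , i≢k , v≡ , w≡) →
                  i≢k (combine-injectiveˡ i _ k _ (trans (sym v≡) w≡)) }
  }

------------------------------------------------------------------------
-- The CONGEST model

-- O(log N)-bit identifiers, with the implied constant a.
ID : ℕ → ℕ → Set
ID a N = Vec Bool (a * ⌈log₂ N ⌉)

-- A node addresses its neighbours through locally numbered ports.
record Network (a : ℕ) {N : ℕ} (G : Graph N) : Set where
  open Graph G
  field
    ident           : Fin N → ID a N
    ident-injective : Injective _≡_ _≡_ ident
    deg             : Fin N → ℕ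
    nbr             : ∀ v → Fin (deg v) → Fin N
    nbr-injective   : ∀ v → Injective _≡_ _≡_ (nbr v)
    nbr-adj         : ∀ v p → Adj v (nbr v p)
    port            : ∀ {v w} → Adj v w → ∃ λ p → nbr v p ≡ w

  -- The port under which the neighbour at port p of v sees v.
  backPort : ∀ v (p : Fin (deg v)) → Fin (deg (nbr v p))
  backPort v p = proj₁ (port (Adj-sym (nbr-adj v p)))

-- An algorithm looking for K_s.  Initially a node knows only N, its own
-- degree and identifier, and its private random string; an element of
-- Fin (2 ^ r) stands for a string of r bits.  A node with output
-- `just c` rejects and presents the identifiers c as a copy of K_s; a
-- node with output `nothing` accepts.
record Algorithm (s a : ℕ) : Set₁ where
  field
    bandwidth  : ℕ
    randomBits : ℕ → ℕ
    rounds     : ℕ → ℕ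

  Message : ℕ → Set
  Message N = Vec Bool (bandwidth * ⌈log₂ N ⌉)

  Coins : ℕ → Set
  Coins N = Fin (2 ^ randomBits N)

  field
    State   : (N d : ℕ) → Set
    init    : ∀ {N d} → ID a N → Coins N → State N d
    send    : ∀ {N d} → State N d → Fin d → Message N
    receive : ∀ {N d} → State N d → (Fin d → Message N) → State N d
    output  : ∀ {N d} → State N d → Maybe (Vec (ID a N) s)

module _ {s a N : ℕ} (A : Algorithm s a) {G : Graph N} (net : Network a G) where
  open Algorithm A
  open Network net

  stateAfter : ℕ → (Fin N → Coins N) → ∀ v → State N (deg v)
  stateAfter zero    ω v = init (ident v) (ω v)
  stateAfter (suc t) ω v = receive (stateAfter t ω v)
    λ p → send (stateAfter t ω (nbr v p)) (backPort v p)

  finalOutput : (Fin N → Coins N) → Fin N → Maybe (Vec (ID a N) s)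
  finalOutput ω v = output (stateAfter (rounds N) ω v)

  Rejects : (Fin N → Coins N) → Fin N → Set
  Rejects ω v = Is-just (finalOutput ω v)

  FindsCopyAndRejects : (Fin N → Coins N) → Fin N → Set
  FindsCopyAndRejects ω v = ∃ λ (c : Fin s → Fin N) →
    IsClique G c × finalOutput ω v ≡ just (tabulate (ident ∘ c))

  -- Pr[E] ≥ 2/3 for independent uniform private coins: some set S of
  -- outcomes contained in E makes up at least 2/3 of all outcomes.
  -- (finToFun is the bijection from Fin (m ^ N) to Fin N → Fin m.)
  Pr≥2/3 : ((Fin N → Coins N) → Set) → Set
  Pr≥2/3 E = ∃ λ (S : Subset ((2 ^ randomBits N) ^ N)) →
    (∀ e → e ∈ S → E (finToFun e)) ×
    2 * (2 ^ randomBits N) ^ N ≤ 3 * ∣ S ∣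

-- On every network, under all outcomes of the coins.
OneSidedError : ∀ {s a} → Algorithm s a → Set₁
OneSidedError {s} {a} A =
  ∀ {N} (G : Graph N) (net : Network a G) ω v → Rejects A net ω v → ContainsK s G

{-# OPTIONS --safe #-}

-- In a Behrend graph every triangle lies inside one of the planted cliques: the edge labels
-- x, y, z of a triangle satisfy p x + q y ≡ (p + q) z, and repeating terms turns this into the
-- equation excluded by the Behrend condition.  So for an edge vw the common neighbours of v and
-- w, together with v and w, are exactly one copy of K_s.  A constant number of rounds suffices
-- to read it off: v picks one neighbour w, asks all its neighbours which of them are w or
-- adjacent to w, and then asks those that said yes to confirm that they are pairwise adjacent.
-- The confirmation makes this deterministic algorithm one-sided on every network.  From the
-- bound on |X| it only needs an x in X, hence an edge to start from.
module Submission where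

open import Defs
open import Data.Bool.Base using (Bool)
import Data.Bool.Properties as Bool
open import Data.Fin.Base using (Fin; zero; suc; toℕ; combine; punchIn; punchOut; finToFun)
open import Data.Fin.Properties
  using (any?; combine-injective; toℕ-fromℕ<; toℕ<n; toℕ-injective; fromℕ<-cong;
         punchIn-injective; punchInᵢ≢i; punchIn-punchOut)
  renaming (_≟_ to _≟ᶠ_)
open import Data.Fin.Subset using (Subset; ∣_∣; _∈_; Nonempty; ⊤)
open import Data.Fin.Subset.Properties using (nonempty?; Empty-unique; ∣⊥∣≡0; ∣⊤∣≡n)
import Data.Integer.Base as ℤ
import Data.Integer.Properties as ℤ
open import Data.List.Base as List using (List; []; _∷_; length; filter; allFin)
open import Data.List.Membership.Propositional using () renaming (_∈_ to _∈ˡ_)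
import Data.List.Membership.Propositional.Properties as ∈ˡ
open import Data.List.Membership.Propositional.Properties.WithK using (unique∧set⇒bag)
import Data.List.Properties as List
open import Data.List.Relation.Binary.BagAndSetEquality using (∼bag⇒↭)
open import Data.List.Relation.Binary.Permutation.Propositional.Properties using (↭-length)
import Data.List.Relation.Unary.All as Allˡ
import Data.List.Relation.Unary.AllPairs as AllPairs
open import Data.List.Relation.Unary.Unique.Propositional using (Unique)
import Data.List.Relation.Unary.Unique.Propositional.Properties as Unique
open import Data.Maybe using (Maybe; just; nothing; Is-just)
import Data.Maybe.Relation.Unary.Any as Maybe
open import Data.Nat.Base
open import Data.Nat.DivMod using (_%_; _/_; m≡m%n+[m/n]*n; [m+kn]%n≡m%n)
open import Data.Nat.Logarithm using (⌈log₂_⌉)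
open import Data.Nat.Primality using (Prime)
open import Data.Nat.Properties hiding (_≟_)
open import Data.Nat.Tactic.RingSolver using (solve-∀)
open import Data.Product.Base using (∃; _×_; _,_; proj₁; proj₂)
import Data.Rational.Unnormalised.Base as ℚ
import Data.Rational.Unnormalised.Properties as ℚ
open import Data.Sum.Base using (_⊎_; inj₁; inj₂)
open import Data.Vec.Base as Vec
  using (Vec; []; _∷_; _++_; tabulate; lookup; replicate; concat; group)
open import Data.Vec.Membership.Propositional using () renaming (_∈_ to _∈ᵛ_)
import Data.Vec.Membership.Propositional.Properties as ∈ᵛ
import Data.Vec.Properties as Vec
open import Data.Vec.Relation.Unary.All as All using (All)
import Data.Vec.Relation.Unary.All.Properties as All
import Data.Vec.Relation.Unary.Any as Anyᵛ
import Data.Vec.Relation.Unary.Any.Properties as Anyᵛ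
open import Function.Base using (_∘_)
open import Function.Bundles using (mk⇔)
open import Function.Definitions using (Injective)
open import Relation.Binary.Definitions using (DecidableEquality; tri<; tri≈; tri>)
open import Relation.Binary.PropositionalEquality
open import Relation.Nullary using (Dec; yes; no; contradiction)
open import Relation.Nullary.Decidable using (_⊎-dec_)

-- The size bound on a Behrend set forces an element.

ι : ℕ → ℚ.ℚᵘ
ι m = ℤ.+ m ℚ./ 1

ι-mono-≤ : ∀ {m n} → m ≤ n → ι m ℚ.≤ ι n
ι-mono-≤ {m} {n} m≤n =
  ℚ.*≤* (subst₂ ℤ._≤_ (sym (ℤ.*-identityʳ (ℤ.+ m))) (sym (ℤ.*-identityʳ (ℤ.+ n))) (ℤ.+≤+ m≤n))

ι-mono-< : ∀ {m n} → m < n → ι m ℚ.< ι n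
ι-mono-< {m} {n} m<n =
  ℚ.*<* (subst₂ ℤ._<_ (sym (ℤ.*-identityʳ (ℤ.+ m))) (sym (ℤ.*-identityʳ (ℤ.+ n))) (ℤ.+<+ m<n))

ι-cancel-< : ∀ {m n} → ι m ℚ.< ι n → m < n
ι-cancel-< {m} {n} (ℚ.*<* m<n) =
  ℤ.drop‿+<+ (subst₂ ℤ._<_ (ℤ.*-identityʳ (ℤ.+ m)) (ℤ.*-identityʳ (ℤ.+ n)) m<n)

-- The exponent `ι e` has denominator 1, so the power of `ι q` unfolds to `ι q` times 1.
≤Pow-ι : ∀ b .{{_ : NonZero b}} e q → q ≤ b ^ e → ≤Pow b (ι e) (ι q)
≤Pow-ι b e q q≤ = inj₂ (ℚ.≤-respˡ-≃ (ℚ.≃-sym (ℚ.*-identityʳ (ι q))) (ι-mono-≤ q≤))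

Pow≤-ι : ∀ b .{{_ : NonZero b}} e q → 0 < q → b ^ e ≤ q → Pow≤ b (ι e) (ι q)
Pow≤-ι b e q 0<q ≤q = ι-mono-< 0<q , ℚ.≤-respʳ-≃ (ℚ.≃-sym (ℚ.*-identityʳ (ι q))) (ι-mono-≤ ≤q)

log₂-below : ∀ x e q → 2 ^ e ≤ q → below x (ι q) → below (log₂ x) (ι e)
log₂-below x e q 2^e≤q q<x = ι q , q<x , Pow≤-ι 2 e q (<-≤-trans (m^n>0 2 e) 2^e≤q) 2^e≤q

n≤2^n : ∀ n → n ≤ 2 ^ n
n≤2^n zero    = z≤n
n≤2^n (suc n) = +-mono-≤ (m^n>0 2 n) (≤-trans (n≤2^n n) (m≤m+n _ 0))

log₂-above : ∀ x q → above x (ι q) → above (log₂ x) (ι q)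
log₂-above x q x<q = ι q , x<q , ≤Pow-ι 2 q q (n≤2^n q)

-- log log n > 1 for n > 16, and the rough bound log y ≤ y makes the exponent of
-- behrendLoss n at most n + 6.
behrendLoss-above : ∀ n .{{_ : NonZero n}} → 16 < n → above (behrendLoss n) (ι (n ^ (n + 6)))
behrendLoss-above n 16<n =
  ι (n + 6) ,
  (ι (n + 6) , ι 1 ,
    -- An upper cut needs a rational strictly above 4, hence 5; together with `1 + n` this gives the
    -- numerator `n + 6`.
    (ι (1 + n) , ι 5 , log₂-above loglog (1 + n) loglog<n , ι-mono-< ≤-refl , ℚ.≤-reflexive sum≃) ,
    log₂-below (log₂ (fromℕ n)) 1 4 (m≤m+n 2 2)
      (log₂-below (fromℕ n) 4 16 ≤-refl (ι-mono-< 16<n)) ,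
    ι-mono-< (s≤s z≤n) ,
    ℚ.≤-reflexive (ℚ.≃-sym (ℚ.*-identityʳ (ι (n + 6))))) ,
  Pow≤-ι n (n + 6) (n ^ (n + 6)) (m^n>0 n (n + 6)) ≤-refl
  where
  loglog : ℝ
  loglog = log₂ (log₂ (fromℕ n))

  loglog<n : above loglog (ι (1 + n))
  loglog<n = log₂-above (log₂ (fromℕ n)) (1 + n) (log₂-above (fromℕ n) (1 + n) (ι-mono-< ≤-refl))

  sum≃ : ι (1 + n) ℚ.+ ι 5 ℚ.≃ ι (n + 6)
  sum≃ = ℚ.*≡* (trans (cong ℤ.+_ (lemma n)) (ℤ.pos-* (n + 6) 1))
    where
    lemma : ∀ n → ((1 + n) * 1 + 5 * 1) * 1 ≡ (n + 6) * 1
    lemma = solve-∀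

-- Any rational above the loss puts 0 strictly below the quotient, and the size bound then gives
-- `0 < ∣ X ∣`.
behrendBound⇒Nonempty : ∀ n .{{_ : NonZero n}} → 16 < n → (X : Subset n) →
  fromℕ n ÷ᵣ behrendLoss n ≤ᵣ fromℕ ∣ X ∣ → Nonempty X
behrendBound⇒Nonempty n 16<n X bound with nonempty? X
... | yes x∈X = x∈X
... | no  X≡∅ = contradiction 0<∣X∣ (subst (λ m → 0 ≮ m) (sym ∣X∣≡0) (λ ()))
  where
  ∣X∣≡0 : ∣ X ∣ ≡ 0
  ∣X∣≡0 = trans (cong ∣_∣ (Empty-unique X≡∅)) (∣⊥∣≡0 n)

  0<∣X∣ : 0 < ∣ X ∣
  0<∣X∣ = ι-cancel-< (bound (ι 0)
    ( ι 0 , ι (n ^ (n + 6)) , ι-mono-< (≤-<-trans z≤n 16<n)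
    , behrendLoss-above n 16<n , ι-mono-< (m^n>0 n (n + 6))
    , ℚ.≤-reflexive (ℚ.*-zeroˡ (ι (n ^ (n + 6))))))

-- Congruence of natural numbers modulo `n`.

module Congruence (n : ℕ) .{{_ : NonZero n}} where

  infix 4 _≋_

  _≋_ : ℕ → ℕ → Set
  x ≋ y = x % n ≡ y % n

  private
    mod-+ : ∀ x y → (x % n + y) % n ≡ (x + y) % n
    mod-+ x y = begin
      (x % n + y) % n               ≡⟨ [m+kn]%n≡m%n (x % n + y) (x / n) n ⟨
      (x % n + y + x / n * n) % n   ≡⟨ cong (_% n) (lemma (x % n) y (x / n * n)) ⟩
      (x % n + x / n * n + y) % n   ≡⟨ cong (λ z → (z + y) % n) (m≡m%n+[m/n]*n x n) ⟨
      (x + y) % n                   ∎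
      where
      open ≡-Reasoning
      lemma : ∀ r y q → r + y + q ≡ r + q + y
      lemma = solve-∀

  +-congʳ-≋ : ∀ z {x y} → x ≋ y → x + z ≋ y + z
  +-congʳ-≋ z {x} {y} x≋y =
    trans (sym (mod-+ x z)) (trans (cong (λ r → (r + z) % n) x≋y) (mod-+ y z))

  +-cong-≋ : ∀ {x x′ y y′} → x ≋ x′ → y ≋ y′ → x + y ≋ x′ + y′
  +-cong-≋ {x} {x′} {y} {y′} x≋ y≋ = begin
    (x + y) % n    ≡⟨ +-congʳ-≋ y x≋ ⟩
    (x′ + y) % n   ≡⟨ cong (_% n) (+-comm x′ y) ⟩
    (y + x′) % n   ≡⟨ +-congʳ-≋ x′ y≋ ⟩
    (y′ + x′) % n  ≡⟨ cong (_% n) (+-comm y′ x′) ⟩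
    (x′ + y′) % n  ∎
    where open ≡-Reasoning

  -- z is cancelled by adding its inverse, the multiple z * (n ∸ 1).
  +-cancelʳ-≋ : ∀ z {x y} → x + z ≋ y + z → x ≋ y
  +-cancelʳ-≋ z {x} {y} eq = trans (sym (absorb x)) (trans (+-congʳ-≋ (z * pred n) eq) (absorb y))
    where
    open ≡-Reasoning
    absorb : ∀ x → x + z + z * pred n ≋ x
    absorb x = begin
      (x + z + z * pred n) % n ≡⟨ cong (_% n) (lemma x z (pred n)) ⟩
      (x + z * suc (pred n)) % n ≡⟨ cong (λ m → (x + z * m) % n) (suc-pred n) ⟩
      (x + z * n) % n ≡⟨ [m+kn]%n≡m%n x z n ⟩
      x % n ∎
      where
      lemma : ∀ x z m → x + z + z * m ≡ x + z * suc m
      lemma = solve-∀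

-- Triangles in Behrend graphs.

total : ∀ {n k} → Vec (Fin n) k → ℕ
total = Vec.sum ∘ Vec.map toℕ

total-++ : ∀ {n k l} (xs : Vec (Fin n) k) (ys : Vec (Fin n) l) → total (xs ++ ys) ≡ total xs + total ys
total-++ xs ys = trans (cong Vec.sum (Vec.map-++ toℕ xs ys)) (Vec.sum-++ (Vec.map toℕ xs))

total-replicate : ∀ {n} k (x : Fin n) → total (replicate k x) ≡ k * toℕ x
total-replicate zero    x = refl
total-replicate (suc k) x = cong (λ t → toℕ x + t) (total-replicate k x)

module Triangles {s n : ℕ} .{{_ : NonZero n}} {X : Subset n} (behrend : BehrendSet s X) where

  open Congruence n

  -- A solution of p x + q y ≡ (p + q) z is padded with copies of z to s - 1 terms.
  weighted-equation : ∀ p q {x y z} → suc p + suc q < s → x ∈ X → y ∈ X → z ∈ X →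
    suc p * toℕ x + suc q * toℕ y ≋ (suc p + suc q) * toℕ z → x ≡ z × y ≡ z
  weighted-equation p q {x} {y} {z} p+q<s x∈X y∈X z∈X eq
    with r , refl ← m≤n⇒∃[o]m+o≡n p+q<s =
    All.head all≡ , All.head (All.++ʳ⁻ (replicate (suc p) x) all≡′)
    where
    xs : Vec (Fin n) (suc p + suc q + r)
    xs = (replicate (suc p) x ++ replicate (suc q) y) ++ replicate r z

    replicate⁺ : ∀ {x} k → x ∈ X → All (_∈ X) (replicate k x)
    replicate⁺ zero    x∈X = All.[]
    replicate⁺ (suc k) x∈X = x∈X All.∷ replicate⁺ k x∈X

    total-xs : total xs ≡ suc p * toℕ x + suc q * toℕ y + r * toℕ z
    total-xs = trans (total-++ (replicate (suc p) x ++ replicate (suc q) y) (replicate r z))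
      (cong₂ _+_ (trans (total-++ (replicate (suc p) x) (replicate (suc q) y))
                        (cong₂ _+_ (total-replicate (suc p) x) (total-replicate (suc q) y)))
                 (total-replicate r z))

    all≡ : All (_≡ z) xs
    all≡ = behrend xs z
      (All.++⁺ (All.++⁺ (replicate⁺ (suc p) x∈X) (replicate⁺ (suc q) y∈X)) (replicate⁺ r z∈X)) z∈X
      (trans (cong (_% n) total-xs)
        (trans (+-congʳ-≋ (r * toℕ z) eq)
          (cong (_% n) (sym (*-distribʳ-+ (toℕ z) (suc p + suc q) r)))))

    all≡′ : All (_≡ z) (replicate (suc p) x ++ replicate (suc q) y)
    all≡′ = All.++ˡ⁻ (replicate (suc p) x ++ replicate (suc q) y) all≡

  -- Edges labelled x, y, z that run between the parts i and k, k and l, l and i close up to a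
  -- triangle: following an edge labelled x from part i to part k adds (k - i) x to the index.
  Closes : (i k l : ℕ) (x y z : Fin n) → Set
  Closes i k l x y z =
    k * toℕ x + l * toℕ y + i * toℕ z ≋ i * toℕ x + k * toℕ y + l * toℕ z

  rotate : ∀ i k l x y z → Closes i k l x y z → Closes k l i y z x
  rotate i k l x y z eq =
    trans (cong (_% n) (cycle (l * toℕ y) (i * toℕ z) (k * toℕ x)))
      (trans eq (cong (_% n) (sym (cycle (k * toℕ y) (l * toℕ z) (i * toℕ x)))))
    where
    cycle : ∀ a b c → a + b + c ≡ c + a + b
    cycle = solve-∀

  -- Exchanging the parts `i` and `k` reverses the orientation of the triangle, so the two sides of
  -- the congruence change places.
  reflect : ∀ i k l x y z → Closes i k l x y z → Closes k i l x z y
  reflect i k l x y z eq =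
    trans (cong (_% n) (swap (i * toℕ x) (l * toℕ z) (k * toℕ y)))
      (trans (sym eq) (cong (_% n) (swap (k * toℕ x) (l * toℕ y) (i * toℕ z))))
    where
    swap : ∀ a b c → a + b + c ≡ a + c + b
    swap = solve-∀

  -- Cancelling i x + k y + i z leaves (k - i) x + (l - k) y ≡ (l - i) z. Its weights are positive
  -- and sum to l - i < s.
  ordered-triangle : ∀ {i k l x y z} → i < k → k < l → l < s → x ∈ X → y ∈ X → z ∈ X →
    Closes i k l x y z → x ≡ z × y ≡ z
  ordered-triangle {i} {x = x} {y} {z} i<k k<l l<s x∈X y∈X z∈X eq
    with p , refl ← m≤n⇒∃[o]m+o≡n i<k
    with q , refl ← m≤n⇒∃[o]m+o≡n k<l =
    weighted-equation p q (≤-<-trans p+q≤l l<s) x∈X y∈X z∈X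
      (+-cancelʳ-≋ (i * toℕ x + (suc i + p) * toℕ y + i * toℕ z)
        (trans (cong (_% n) (lhs i p q (toℕ x) (toℕ y) (toℕ z)))
          (trans eq (cong (_% n) (rhs i p q (toℕ x) (toℕ y) (toℕ z))))))
    where
    p+q≤l : suc p + suc q ≤ suc (suc i + p) + q
    p+q≤l = subst (suc p + suc q ≤_) (rearrange i p q) (m≤n+m (suc p + suc q) i)
      where
      rearrange : ∀ i p q → i + (suc p + suc q) ≡ suc (suc i + p) + q
      rearrange = solve-∀

    lhs : ∀ i p q x y z →
      suc p * x + suc q * y + (i * x + (suc i + p) * y + i * z) ≡
      (suc i + p) * x + (suc (suc i + p) + q) * y + i * z
    lhs = solve-∀

    rhs : ∀ i p q x y z →
      i * x + (suc i + p) * y + (suc (suc i + p) + q) * z ≡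
      (suc p + suc q) * z + (i * x + (suc i + p) * y + i * z)
    rhs = solve-∀

  -- Each of the six orders of the parts becomes the increasing one after at most two rotations,
  -- preceded by a reflection for the odd orders.
  triangle : ∀ i k l x y z → i ≢ k → k ≢ l → l ≢ i → i < s → k < s → l < s →
    x ∈ X → y ∈ X → z ∈ X → Closes i k l x y z → x ≡ z
  triangle i k l x y z i≢k k≢l l≢i i<s k<s l<s x∈X y∈X z∈X ikl
    with <-cmp i k | <-cmp k l | <-cmp l i
  ... | tri≈ _ i≡k _ | _            | _            = contradiction i≡k i≢k
  ... | _            | tri≈ _ k≡l _ | _            = contradiction k≡l k≢l
  ... | _            | _            | tri≈ _ l≡i _ = contradiction l≡i l≢i
  ... | tri< i<k _ _ | tri< k<l _ _ | _            =
    proj₁ (ordered-triangle i<k k<l l<s x∈X y∈X z∈X ikl)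
  ... | tri> _ _ _   | tri< k<l _ _ | tri< l<i _ _ =
    sym (proj₂ (ordered-triangle k<l l<i i<s y∈X z∈X x∈X (rotate i k l x y z ikl)))
  ... | tri< i<k _ _ | tri> _ _ _   | tri< l<i _ _ =
    let kli = rotate i k l x y z ikl
        lik = rotate k l i y z x kli
        z≡y , x≡y = ordered-triangle l<i i<k k<s z∈X x∈X y∈X lik
    in trans x≡y (sym z≡y)
  ... | tri> _ _ k<i | tri< _ _ _   | tri> _ _ i<l =
    let x≡y , z≡y = ordered-triangle k<i i<l l<s x∈X z∈X y∈X (reflect i k l x y z ikl)
    in trans x≡y (sym z≡y)
  ... | tri< _ _ _   | tri> _ _ l<k | tri> _ _ i<l =
    let kil = reflect i k l x y z ikl
        ilk = rotate k i l x z y kil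
    in sym (proj₁ (ordered-triangle i<l l<k k<s z∈X y∈X x∈X ilk))
  ... | tri> _ _ k<i | tri> _ _ l<k | _            =
    let kil = reflect i k l x y z ikl
        ilk = rotate k i l x z y kil
        lki = rotate i l k z y x ilk
    in proj₂ (ordered-triangle l<k k<i i<s y∈X x∈X z∈X lki)

  open Graph (BK s n X)

  private
    C : (x j : Fin n) → Fin s → Fin (s * n)
    C = cliqueVertex s n

  cliqueVertex-≋ : ∀ {x j i y j′ i′} → C x j i ≡ C y j′ i′ →
    i ≡ i′ × toℕ j + toℕ i * toℕ x ≋ toℕ j′ + toℕ i * toℕ y
  cliqueVertex-≋ {i = i} {i′ = i′} eq with refl , eq₂ ← combine-injective i _ i′ _ eq =
    refl , trans (sym (toℕ-fromℕ< _)) (trans (cong toℕ eq₂) (toℕ-fromℕ< _))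

  ≋⇒cliqueVertex≡ : ∀ x j j′ i → toℕ j + toℕ i * toℕ x ≋ toℕ j′ + toℕ i * toℕ x → C x j i ≡ C x j′ i
  ≋⇒cliqueVertex≡ x j j′ i eq = cong (combine i) (fromℕ<-cong _ _ eq _ _)

  clique-Adj : ∀ {x} j {i k} → x ∈ X → i ≢ k → Adj (C x j i) (C x j k)
  clique-Adj {x} j {i} {k} x∈X i≢k = x , j , x∈X , i , k , i≢k , refl , refl

  cliqueVertex-injective : ∀ {x j i k} → C x j i ≡ C x j k → i ≡ k
  cliqueVertex-injective = proj₁ ∘ cliqueVertex-≋

  -- `j`, `j₁`, `j₂` are the base indices of the planted cliques containing the three sides; each
  -- hypothesis says that two of these cliques meet in a corner. In the sum, with the first two
  -- reversed, the base indices cancel.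
  closes : ∀ {ix kx ky lz ly iz} j j₁ j₂ →
    j + ix ≋ j₁ + iz → j₁ + lz ≋ j₂ + ly → j + kx ≋ j₂ + ky →
    kx + ly + iz ≋ ix + ky + lz
  closes {ix} {kx} {ky} {lz} {ly} {iz} j j₁ j₂ v≋ u≋ w≋ = +-cancelʳ-≋ (j + j₁ + j₂)
    (trans (cong (_% n) (lhs j j₁ j₂ kx ly iz))
      (trans (+-cong-≋ (+-cong-≋ (sym v≋) (sym u≋)) w≋)
        (cong (_% n) (rhs j j₁ j₂ ix ky lz))))
    where
    lhs : ∀ j j₁ j₂ a b c → a + b + c + (j + j₁ + j₂) ≡ (j₁ + c) + (j₂ + b) + (j + a)
    lhs = solve-∀

    rhs : ∀ j j₁ j₂ a b c → (j + a) + (j₁ + c) + (j₂ + b) ≡ a + b + c + (j + j₁ + j₂)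
    rhs = solve-∀

  common-neighbour∈clique : ∀ x j i k {u} → x ∈ X → i ≢ k →
    Adj (C x j i) u → Adj u (C x j k) → ∃ λ l → u ≡ C x j l
  common-neighbour∈clique x j i k x∈X i≢k
    (z , j₁ , z∈X , i₁ , l , i≢l , v≡₁ , refl) (y , j₂ , y∈X , l₂ , k₂ , l≢k , u≡₂ , w≡₂)
    with refl , v≋ ← cliqueVertex-≋ v≡₁
    with refl , u≋ ← cliqueVertex-≋ u≡₂
    with refl , w≋ ← cliqueVertex-≋ w≡₂
    with refl ← triangle (toℕ i) (toℕ k) (toℕ l) x y z
                  (i≢k ∘ toℕ-injective) (l≢k ∘ sym ∘ toℕ-injective) (i≢l ∘ sym ∘ toℕ-injective)
                  (toℕ<n i) (toℕ<n k) (toℕ<n l) x∈X y∈X z∈X (closes (toℕ j) (toℕ j₁) (toℕ j₂) v≋ u≋ w≋)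
    -- With equal labels, agreement of the indices at the common corner in part `i` gives congruent
    -- base indices, hence agreement in part `l` as well.
    = l , ≋⇒cliqueVertex≡ x j₁ j l
            (+-congʳ-≋ (toℕ l * toℕ x) (sym (+-cancelʳ-≋ (toℕ i * toℕ x) v≋)))

-- Lists and vectors as enumerations.

module _ {A : Set} where

  concat-injective : ∀ {m n} (xss yss : Vec (Vec A m) n) → concat xss ≡ concat yss → xss ≡ yss
  concat-injective []         []         eq = refl
  concat-injective (xs ∷ xss) (ys ∷ yss) eq =
    let xs≡ys , eq′ = Vec.++-injective xs ys eq in
    cong₂ _∷_ xs≡ys (concat-injective xss yss eq′)

  -- A query has fixed length, while the number of confirming neighbours varies. Truncating or
  -- padding cannot harm soundness, because the verdict checks the resulting query afresh.
  fit : A → ∀ n → List A → Vec A n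
  fit d zero    xs       = []
  fit d (suc n) []       = d ∷ fit d n []
  fit d (suc n) (x ∷ xs) = x ∷ fit d n xs

  toList-fit : ∀ d {n} xs → length xs ≡ n → Vec.toList (fit d n xs) ≡ xs
  toList-fit d []       refl = refl
  toList-fit d (x ∷ xs) refl = cong (x ∷_) (toList-fit d xs refl)

  -- Duplicate-free lists with the same members are permutations of each other; `xs` is compared
  -- with the tabulation of `f`.
  length≡enumeration : ∀ {n} {f : Fin n → A} {xs} → Injective _≡_ _≡_ f → Unique xs →
    (∀ {x} → x ∈ˡ xs → ∃ λ i → x ≡ f i) → (∀ i → f i ∈ˡ xs) → length xs ≡ n
  length≡enumeration {n} {f} {xs} f-inj xs! to from = trans
    (↭-length (∼bag⇒↭ (unique∧set⇒bag xs! (Unique.tabulate⁺ f-inj)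
      (mk⇔ (λ x∈xs → let i , x≡fi = to x∈xs in
                      subst (_∈ˡ List.tabulate f) (sym x≡fi) (∈ˡ.∈-tabulate⁺ i))
           (λ x∈f → let i , x≡fi = ∈ˡ.∈-tabulate⁻ x∈f in
                     subst (_∈ˡ xs) (sym x≡fi) (from i))))))
    (List.length-tabulate f)

  lookup-injective : ∀ {xs : List A} → Unique xs → Injective _≡_ _≡_ (List.lookup xs)
  lookup-injective (_  AllPairs.∷ _)  {zero}  {zero}  _  = refl
  lookup-injective (x∉ AllPairs.∷ _)  {zero}  {suc j} eq =
    contradiction eq (Allˡ.lookup x∉ (∈ˡ.∈-lookup j))
  lookup-injective (x∉ AllPairs.∷ _)  {suc i} {zero}  eq =
    contradiction (sym eq) (Allˡ.lookup x∉ (∈ˡ.∈-lookup i))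
  lookup-injective (_  AllPairs.∷ xs!) {suc i} {suc j} eq = cong suc (lookup-injective xs! eq)

  lookup-extensional : ∀ {n} {xs ys : Vec A n} → (∀ i → lookup xs i ≡ lookup ys i) → xs ≡ ys
  lookup-extensional {xs = xs} {ys} eq =
    trans (sym (Vec.tabulate∘lookup xs)) (trans (Vec.tabulate-cong eq) (Vec.tabulate∘lookup ys))

module _ {A B : Set} (f : A → B) where

  map≡toList⇒tabulate : ∀ xs (ys : Vec B (length xs)) →
    List.map f xs ≡ Vec.toList ys → ys ≡ tabulate (f ∘ List.lookup xs)
  map≡toList⇒tabulate []       []       _  = refl
  map≡toList⇒tabulate (x ∷ xs) (y ∷ ys) eq =
    let fx≡y , eq′ = List.∷-injective eq in
    cong₂ _∷_ (sym fx≡y) (map≡toList⇒tabulate xs ys eq′)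

  -- The equation fixes the length of `xs` at `n`, so looking up positions in `xs` is the
  -- enumeration wanted.
  map≡toList⇒enumeration : ∀ {n} xs (ys : Vec B n) → Unique xs → List.map f xs ≡ Vec.toList ys →
    ∃ λ (c : Fin n → A) → Injective _≡_ _≡_ c × (∀ i → c i ∈ˡ xs) × ys ≡ tabulate (f ∘ c)
  map≡toList⇒enumeration xs ys xs! eq
    with refl ← trans (sym (List.length-map f xs)) (trans (cong length eq) (Vec.length-toList ys)) =
    List.lookup xs , lookup-injective xs! , ∈ˡ.∈-lookup , map≡toList⇒tabulate xs ys eq

Is-just⇒≡just : ∀ {A : Set} {m : Maybe A} → Is-just m → ∃ λ x → m ≡ just x
Is-just⇒≡just {m = just x} _ = x , refl

-- The protocol as run by a single node.

module Node (I : Set) (_≟_ : DecidableEquality I) (k : ℕ) where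

  -- The clique sought has `suc (suc k)` vertices. The asking node is one of them, and a query lists
  -- the others.
  Word Verdict : Set
  Word    = Vec I (suc k)
  Verdict = Maybe (Vec I (suc (suc k)))

  module _ {d : ℕ} (me : I) (names : Fin d → I) where

    -- A node counts as knowing itself, so that a clique member can confirm a query in which it is
    -- listed.
    Known : I → Set
    Known q = q ≡ me ⊎ ∃ λ p → q ≡ names p

    known? : ∀ q → Dec (Known q)
    known? q = (q ≟ me) ⊎-dec any? (λ p → q ≟ names p)

    -- A node denies knowledge of q by answering with its own identifier; on a network this
    -- cannot be mistaken for q, since its own identifier counts as known.
    echo : I → I
    echo q with known? q
    ... | yes _ = q
    ... | no  _ = me

    echo≡⇒Known : ∀ {q} → echo q ≡ q → Known q
    echo≡⇒Known {q} eq with known? q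
    ... | yes known = known
    ... | no  _     = inj₁ (sym eq)

    Known⇒echo≡ : ∀ {q} → Known q → echo q ≡ q
    Known⇒echo≡ {q} known with known? q
    ... | yes _      = refl
    ... | no  ¬known = contradiction known ¬known

  -- One neighbour's name is repeated to fill the word. An isolated node has nobody to ask and uses
  -- its own name as filler.
  initialQuery : ∀ {d} → I → (Fin d → I) → Word
  initialQuery {zero}  me names = replicate (suc k) me
  initialQuery {suc d} me names = replicate (suc k) (names zero)

  initialQuery≡ : ∀ {d} me (names : Fin d → I) → Fin d →
    ∃ λ p → initialQuery me names ≡ replicate (suc k) (names p)
  initialQuery≡ {suc d} me names _ = zero , refl

  confirmed : ∀ {d} → Word → (Fin d → Word) → List (Fin d)
  confirmed {d} query replies = filter (λ p → Vec.≡-dec _≟_ (replies p) query) (allFin d)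

  verdict : I → Word → List I → Verdict
  verdict me query roster with List.≡-dec _≟_ roster (Vec.toList query)
  ... | yes _ = just (me ∷ query)
  ... | no  _ = nothing

  verdict⁺ : ∀ me query {roster} → roster ≡ Vec.toList query → Is-just (verdict me query roster)
  verdict⁺ me query {roster} eq with List.≡-dec _≟_ roster (Vec.toList query)
  ... | yes _  = Maybe.just _
  ... | no  ≢ = contradiction eq ≢

  verdict⁻ : ∀ me query {roster out} → verdict me query roster ≡ just out →
    roster ≡ Vec.toList query × out ≡ me ∷ query
  verdict⁻ me query {roster} eq with List.≡-dec _≟_ roster (Vec.toList query)
  verdict⁻ me query {roster} refl | yes roster≡ = roster≡ , refl

  -- Every node alternates between sending out a query and answering its neighbours' queries.
  -- The neighbours that confirm a query become the next query, and the verdict is positive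
  -- when a query is confirmed by exactly the nodes that it lists.
  data State (d : ℕ) : Set where
    greeting  : I → State d
    asking    : I → (Fin d → I) → Word → Verdict → State d
    answering : I → (Fin d → I) → Word → (Fin d → Word) → State d

  say : ∀ {d} → State d → Fin d → Word
  say (greeting me)                  p = replicate (suc k) me
  say (asking _ _ query _)           p = query
  say (answering me names _ queries) p = Vec.map (echo me names) (queries p)

  hear : ∀ {d} → State d → (Fin d → Word) → State d
  hear (greeting me) heard = asking me names (initialQuery me names) nothing
    where names = Vec.head ∘ heard
  hear (asking me names query _) heard = answering me names query heard
  hear (answering me names query _) heard =
    asking me names (fit me (suc k) roster) (verdict me query roster)
    where roster = List.map names (confirmed query heard)

  answer : ∀ {d} → State d → Verdict
  answer (asking _ _ _ v) = v
  answer _                = nothing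

-- The algorithm in the CONGEST model.

module CliqueSearch (a k : ℕ) where

  module At (N : ℕ) = Node (ID a N) (Vec.≡-dec Bool._≟_) k

  Packet : ℕ → Set
  Packet N = Vec Bool (suc k * a * ⌈log₂ N ⌉)

  -- Abstract because unfolding the coding makes type checking prohibitively slow.
  abstract

    encode : ∀ N → At.Word N → Packet N
    encode N w = Vec.cast (sym (*-assoc (suc k) a ⌈log₂ N ⌉)) (concat w)

    decode : ∀ N → Packet N → At.Word N
    decode N b = proj₁ (group (suc k) (a * ⌈log₂ N ⌉) (Vec.cast (*-assoc (suc k) a ⌈log₂ N ⌉) b))

    decode-encode : ∀ N w → decode N (encode N w) ≡ w
    decode-encode N w = concat-injective _ w (trans
      (sym (proj₂ (group (suc k) (a * ⌈log₂ N ⌉) _)))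
      (trans (Vec.cast-trans (sym assoc) assoc (concat w)) (Vec.cast-is-id refl (concat w))))
      where
      assoc : suc k * a * ⌈log₂ N ⌉ ≡ suc k * (a * ⌈log₂ N ⌉)
      assoc = *-assoc (suc k) a ⌈log₂ N ⌉

  algorithm : Algorithm (suc (suc k)) a
  algorithm = record
    { bandwidth  = suc k * a
    ; randomBits = λ _ → 0
    -- One round of greetings, then a round of asking and a round of answering for each of two
    -- queries.
    ; rounds     = λ _ → 5
    ; State      = At.State
    ; init       = λ {N} me _ → At.greeting {N} me
    ; send       = λ {N} st p → encode N (At.say N st p)
    ; receive    = λ {N} st heard → At.hear N st (decode N ∘ heard)
    ; output     = λ {N} → At.answer N
    }

  -- Soundness and completeness of a run on a network.

  module Run {N : ℕ} {G : Graph N} (net : Network a G) where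

    open Graph G
    open Network net
    open At N

    -- The coding is left in place so that this agrees by computation with the names stored after
    -- the first round; `reply` below is written in the same way.
    names : ∀ v → Fin (deg v) → ID a N
    names v p = Vec.head (decode N (encode N (replicate (suc k) (ident (nbr v p)))))

    names≡ : ∀ v p → names v p ≡ ident (nbr v p)
    names≡ v p = cong Vec.head (decode-encode N (replicate (suc k) (ident (nbr v p))))

    KnownAt : Fin N → ID a N → Set
    KnownAt v = Known (ident v) (names v)

    KnownAt⇒Adj : ∀ {v w} → KnownAt v (ident w) → v ≡ w ⊎ Adj v w
    KnownAt⇒Adj {v} (inj₁ w≡v)         = inj₁ (ident-injective (sym w≡v))
    KnownAt⇒Adj {v} (inj₂ (p , w≡p)) =
      inj₂ (subst (Adj v) (ident-injective (sym (trans w≡p (names≡ v p)))) (nbr-adj v p))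

    Adj⇒KnownAt : ∀ {v w} → v ≡ w ⊎ Adj v w → KnownAt v (ident w)
    Adj⇒KnownAt     (inj₁ v≡w) = inj₁ (cong ident (sym v≡w))
    Adj⇒KnownAt {v} (inj₂ v~w) = let p , p≡w = port v~w in
      inj₂ (p , trans (cong ident (sym p≡w)) (sym (names≡ v p)))

    module Exchange (query : Fin N → Word) where

      reply : ∀ v → Fin (deg v) → Word
      reply v p = decode N (encode N (Vec.map (echo (ident (nbr v p)) (names (nbr v p)))
        (decode N (encode N (query (nbr (nbr v p) (backPort v p)))))))

      -- The neighbour at `p` answers the query heard on its back port, and the node behind that
      -- port is `v` again.
      reply≡ : ∀ v p → reply v p ≡ Vec.map (echo (ident (nbr v p)) (names (nbr v p))) (query v)
      reply≡ v p = trans (decode-encode N _) (cong (Vec.map _) (trans (decode-encode N _)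
        (cong query (proj₂ (port (Adj-sym (nbr-adj v p)))))))

      Confirms : ∀ v → Fin (deg v) → Set
      Confirms v p = ∀ i → KnownAt (nbr v p) (lookup (query v) i)

      Confirms⇒reply≡ : ∀ {v p} → Confirms v p → reply v p ≡ query v
      Confirms⇒reply≡ {v} {p} confirms = trans (reply≡ v p)
        (lookup-extensional λ i → trans (Vec.lookup-map i _ (query v)) (Known⇒echo≡ _ _ (confirms i)))

      reply≡⇒Confirms : ∀ {v p} → reply v p ≡ query v → Confirms v p
      reply≡⇒Confirms {v} {p} eq i = echo≡⇒Known _ _
        (trans (sym (Vec.lookup-map i _ (query v)))
          (cong (λ w → lookup w i) (trans (sym (reply≡ v p)) eq)))

      confirming : ∀ v → List (Fin (deg v))
      confirming v = confirmed (query v) (reply v)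

      roster : Fin N → List (ID a N)
      roster v = List.map (names v) (confirming v)

      confirms? : ∀ v p → Dec (reply v p ≡ query v)
      confirms? v p = Vec.≡-dec (Vec.≡-dec Bool._≟_) (reply v p) (query v)

      ∈-confirming⁺ : ∀ {v p} → Confirms v p → p ∈ˡ confirming v
      ∈-confirming⁺ {v} {p} confirms =
        ∈ˡ.∈-filter⁺ (confirms? v) (∈ˡ.∈-allFin p) (Confirms⇒reply≡ confirms)

      ∈-confirming⁻ : ∀ {v p} → p ∈ˡ confirming v → Confirms v p
      ∈-confirming⁻ {v} {p} p∈ =
        reply≡⇒Confirms (proj₂ (∈ˡ.∈-filter⁻ (confirms? v) {xs = allFin (deg v)} p∈))

      confirming-Unique : ∀ v → Unique (confirming v)
      confirming-Unique v = Unique.filter⁺ _ (Unique.allFin⁺ (deg v))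

      -- When roster and query agree, the listed nodes are neighbours of `v` each of which knows all
      -- listed names. Distinct ports lead to distinct vertices, so knowing another listed node
      -- means being adjacent to it.
      verdict-sound : ∀ v {out} → verdict (ident v) (query v) (roster v) ≡ just out →
        ∃ λ c → IsClique G c × out ≡ tabulate (ident ∘ c)
      verdict-sound v eq
        with roster≡ , refl ← verdict⁻ (ident v) (query v) eq
        with c , c-inj , c∈ , query≡ ←
               map≡toList⇒enumeration (names v) (confirming v) (query v)
                 (confirming-Unique v) roster≡
        = clique , isClique , cong (ident v ∷_) (trans query≡ (Vec.tabulate-cong (names≡ v ∘ c)))
        where
        clique : Fin (suc (suc k)) → Fin N
        clique zero    = v
        clique (suc i) = nbr v (c i)

        isClique : IsClique G clique
        isClique zero    zero    0≢0 = contradiction refl 0≢0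
        isClique zero    (suc j) _   = nbr-adj v (c j)
        isClique (suc i) zero    _   = Adj-sym (nbr-adj v (c i))
        isClique (suc i) (suc j) i≢j
          with KnownAt⇒Adj (subst (KnownAt _) query-j (∈-confirming⁻ (c∈ i) j))
          where
          query-j : lookup (query v) j ≡ ident (nbr v (c j))
          query-j = trans (cong (λ w → lookup w j) query≡)
            (trans (Vec.lookup∘tabulate (names v ∘ c) j) (names≡ v (c j)))
        ... | inj₁ eq  = contradiction (cong suc (c-inj (nbr-injective v eq))) i≢j
        ... | inj₂ adj = adj

    -- Both lists filter the ports in the same order, so equivalent conditions give equal lists and
    -- not merely equal sets.
    confirming-≐ : ∀ query query′ {v} → let open Exchange in
      (∀ {p} → Confirms query v p → Confirms query′ v p) →
      (∀ {p} → Confirms query′ v p → Confirms query v p) →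
      confirming query v ≡ confirming query′ v
    confirming-≐ query query′ {v} to from = List.filter-≐ _ _
      ( (Exchange.Confirms⇒reply≡ query′ ∘ to   ∘ Exchange.reply≡⇒Confirms query)
      , (Exchange.Confirms⇒reply≡ query  ∘ from ∘ Exchange.reply≡⇒Confirms query′)) (allFin (deg v))

    query₁ query₂ : Fin N → Word
    query₁ v = initialQuery (ident v) (names v)
    query₂ v = fit (ident v) (suc k) (Exchange.roster query₁ v)

    -- The output after five rounds computes to the verdict on `query₂`.
    Rejects⇒finds : ∀ ω v → Rejects algorithm net ω v → FindsCopyAndRejects algorithm net ω v
    Rejects⇒finds ω v rejects =
      let out , output≡ = Is-just⇒≡just rejects
          c , isClique , out≡ = Exchange.verdict-sound query₂ v output≡
      in c , isClique , trans output≡ (cong just out≡)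

    -- Here the neighbours of `v` that are equal or adjacent to the one at `p₀` are exactly the
    -- `f i`, and these form a clique with `v`. Both queries are then confirmed by exactly these
    -- neighbours.
    module Complete {v : Fin N} (f : Fin (suc k) → Fin N) (f-injective : Injective _≡_ _≡_ f)
      (v~f : ∀ i → Adj v (f i)) (f-clique : IsClique G f)
      (p₀ : Fin (deg v)) (query₁≡ : query₁ v ≡ replicate (suc k) (names v p₀))
      (i₀ : Fin (suc k)) (p₀≡ : nbr v p₀ ≡ f i₀)
      (covers : ∀ {u} → Adj v u → u ≡ nbr v p₀ ⊎ Adj u (nbr v p₀) → ∃ λ i → u ≡ f i)
      where

      Member : Fin (deg v) → Set
      Member p = ∃ λ i → nbr v p ≡ f i

      members-know : ∀ {p q} → Member p → Member q → KnownAt (nbr v p) (names v q)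
      members-know {p} {q} (i , p≡) (j , q≡) =
        subst (KnownAt (nbr v p)) (sym (names≡ v q)) (Adj⇒KnownAt near)
        where
        near : nbr v p ≡ nbr v q ⊎ Adj (nbr v p) (nbr v q)
        near rewrite p≡ | q≡ with i ≟ᶠ j
        ... | yes i≡j = inj₁ (cong f i≡j)
        ... | no  i≢j = inj₂ (f-clique i j i≢j)

      knows-p₀⇒Member : ∀ {p} → KnownAt (nbr v p) (names v p₀) → Member p
      knows-p₀⇒Member {p} known =
        covers (nbr-adj v p) (KnownAt⇒Adj (subst (KnownAt _) (names≡ v p₀) known))

      module E₁ = Exchange query₁
      module E₂ = Exchange query₂

      Confirms₁⇒Member : ∀ {p} → E₁.Confirms v p → Member p
      Confirms₁⇒Member confirms =
        knows-p₀⇒Member (subst (KnownAt _) (cong Vec.head query₁≡) (head-known confirms))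
        where
        head-known : ∀ {u} → (∀ i → KnownAt u (lookup (query₁ v) i)) → KnownAt u (Vec.head (query₁ v))
        head-known known with query₁ v | known
        ... | _ ∷ _ | known′ = known′ zero

      Member⇒Confirms₁ : ∀ {p} → Member p → E₁.Confirms v p
      Member⇒Confirms₁ member i = subst (KnownAt _)
        (sym (trans (cong (λ w → lookup w i) query₁≡) (Vec.lookup-replicate i (names v p₀))))
        (members-know member (i₀ , p₀≡))

      -- The confirming ports are those leading to the `f i`, one for each `i`. Hence `fit` neither
      -- truncates nor pads.
      confirming-length : length (E₁.confirming v) ≡ suc k
      confirming-length = length≡enumeration port-injective (E₁.confirming-Unique v)
        (λ p∈ → let i , p≡ = Confirms₁⇒Member (E₁.∈-confirming⁻ p∈) in
                i , nbr-injective v (trans p≡ (sym (proj₂ (port (v~f i))))))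
        (λ i → E₁.∈-confirming⁺ (Member⇒Confirms₁ (i , proj₂ (port (v~f i)))))
        where
        port-injective : Injective _≡_ _≡_ (λ i → proj₁ (port (v~f i)))
        port-injective {i} {j} eq = f-injective
          (trans (sym (proj₂ (port (v~f i)))) (trans (cong (nbr v) eq) (proj₂ (port (v~f j)))))

      query₂≡ : Vec.toList (query₂ v) ≡ E₁.roster v
      query₂≡ = toList-fit (ident v) (E₁.roster v)
        (trans (List.length-map (names v) (E₁.confirming v)) confirming-length)

      -- The neighbour at `p₀` confirmed the first query, so the second one lists it, and whoever
      -- confirms the second knows it.
      Confirms₂⇒Member : ∀ {p} → E₂.Confirms v p → Member p
      Confirms₂⇒Member confirms = knows-p₀⇒Member
        (subst (KnownAt _) (sym (Anyᵛ.lookup-index p₀∈)) (confirms (Anyᵛ.index p₀∈)))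
        where
        p₀∈ : names v p₀ ∈ᵛ query₂ v
        p₀∈ = ∈ᵛ.∈-toList⁻ (subst (names v p₀ ∈ˡ_) (sym query₂≡)
          (∈ˡ.∈-map⁺ (names v) (E₁.∈-confirming⁺ (Member⇒Confirms₁ (i₀ , p₀≡)))))

      Member⇒Confirms₂ : ∀ {p} → Member p → E₂.Confirms v p
      Member⇒Confirms₂ member i =
        let q , q∈ , i≡q = ∈ˡ.∈-map⁻ (names v) (subst (lookup (query₂ v) i ∈ˡ_) query₂≡
                             (∈ᵛ.∈-toList⁺ (∈ᵛ.∈-lookup i (query₂ v))))
        in subst (KnownAt _) (sym i≡q) (members-know member (Confirms₁⇒Member (E₁.∈-confirming⁻ q∈)))

      -- Equal sets of confirming ports make the second roster equal to the first, which is the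
      -- content of `query₂`.
      rejects : ∀ ω → Rejects algorithm net ω v
      rejects ω = verdict⁺ (ident v) (query₂ v) (trans
        (cong (List.map (names v)) (confirming-≐ query₂ query₁
          (λ c → Member⇒Confirms₁ (Confirms₂⇒Member c))
          (λ c → Member⇒Confirms₂ (Confirms₁⇒Member c))))
        (sym query₂≡))

    -- The hypothesis ranges over all neighbours `w`, since the port numbering decides which one the
    -- first query names.
    rejects : ∀ v → Fin (deg v) →
      (∀ {w} → Adj v w → ∃ λ (f : Fin (suc k) → Fin N) → Injective _≡_ _≡_ f ×
        (∀ i → Adj v (f i)) × IsClique G f × (∃ λ i → w ≡ f i) ×
        (∀ {u} → Adj v u → u ≡ w ⊎ Adj u w → ∃ λ i → u ≡ f i)) →
      ∀ ω → Rejects algorithm net ω v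
    rejects v p unique =
      let p₀ , query₁≡ = initialQuery≡ (ident v) (names v) p
          f , f-inj , v~f , f-clique , (i₀ , p₀≡) , covers = unique (nbr-adj v p₀)
      in Complete.rejects f f-inj v~f f-clique p₀ query₁≡ i₀ p₀≡ covers

-- The unique clique through an edge, and the theorem.

unique-clique-through-edge : ∀ {m n} .{{_ : NonZero n}} {X : Subset n} → BehrendSet (suc m) X →
  let open Graph (BK (suc m) n X) in ∀ {v w} → Adj v w →
  ∃ λ (f : Fin m → Fin (suc m * n)) → Injective _≡_ _≡_ f ×
    (∀ i → Adj v (f i)) × IsClique (BK (suc m) n X) f × (∃ λ i → w ≡ f i) ×
    (∀ {u} → Adj v u → u ≡ w ⊎ Adj u w → ∃ λ i → u ≡ f i)
unique-clique-through-edge {m} {n} {X} behrend (x , j , x∈X , i , k , i≢k , refl , refl) =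
  -- `punchIn i` runs through the parts other than the part `i` of `v`.
  C ∘ punchIn i ,
  punchIn-injective i _ _ ∘ cliqueVertex-injective ,
  (λ l → clique-Adj j x∈X (punchInᵢ≢i i l ∘ sym)) ,
  (λ l l′ l≢l′ → clique-Adj j x∈X (l≢l′ ∘ punchIn-injective i l l′)) ,
  member k i≢k ,
  covers
  where
  open Triangles {suc m} {n} {X} behrend
  open Graph (BK (suc m) n X)

  C : Fin (suc m) → Fin (suc m * n)
  C = cliqueVertex (suc m) n x j

  member : ∀ l → i ≢ l → ∃ λ l′ → C l ≡ C (punchIn i l′)
  member l i≢l = punchOut i≢l , cong C (sym (punchIn-punchOut i≢l))

  covers : ∀ {u} → Adj (C i) u → u ≡ C k ⊎ Adj u (C k) → ∃ λ l → u ≡ C (punchIn i l)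
  covers v~u (inj₁ refl) = member k i≢k
  covers v~u (inj₂ u~w) with l , refl ← common-neighbour∈clique x j i k x∈X i≢k v~u u~w =
    -- `u` lies outside part `i`, since otherwise it would be `v` and the edge a loop.
    member l (λ { refl → irrefl v~u })

Pr≥2/3-certain : ∀ {s a N} (A : Algorithm s a) {G : Graph N} (net : Network a G)
  {E : (Fin N → Algorithm.Coins A N) → Set} → (∀ ω → E ω) → Pr≥2/3 A net E
Pr≥2/3-certain {N = N} A net certain =
  ⊤ , (λ e _ → certain (finToFun e)) ,
  subst (λ c → 2 * outcomes ≤ 3 * c) (sym (∣⊤∣≡n outcomes)) (*-monoˡ-≤ outcomes (n≤1+n 2))
  where
  outcomes : ℕ
  outcomes = (2 ^ Algorithm.randomBits A N) ^ N

mainTheorem11 : ∀ (s : ℕ) → 5 ≤ s → s % 2 ≡ 1 → ∀ (a : ℕ) →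
    ∃ λ (A : Algorithm s a) →
    OneSidedError A ×
    IsO[n^o[1]] (λ n → Algorithm.rounds A (s * n)) ×
    ∃ λ (n₀ : ℕ) →
    ∀ (n : ℕ) .{{_ : NonZero n}} → Prime n → n₀ ≤ n →
    ∀ (X : Subset n) →
    fromℕ n ÷ᵣ behrendLoss n ≤ᵣ fromℕ ∣ X ∣ →
    BehrendSet s X →
    ∀ (net : Network a (BK s n X)) →
    Pr≥2/3 A net (λ ω → ∃ λ v → FindsCopyAndRejects A net ω v)
mainTheorem11 (suc (suc k)) (s≤s (s≤s _)) _ a =
  algorithm , oneSided , constantRounds , 17 , findsCopy
  where
  open CliqueSearch a k

  oneSided : OneSidedError algorithm
  oneSided G net ω v rejects =
    let c , isClique , _ = Run.Rejects⇒finds net ω v rejects in c , isClique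

  constantRounds : IsO[n^o[1]] (λ _ → 5)
  constantRounds =
    (λ _ → 1) , (λ k → 1 , λ n 1≤n → subst (_≤ n) (sym (^-zeroˡ k)) 1≤n) , 5 , 0 , λ _ _ → ≤-refl

  findsCopy : ∀ n .{{_ : NonZero n}} → Prime n → 17 ≤ n → ∀ X →
    fromℕ n ÷ᵣ behrendLoss n ≤ᵣ fromℕ ∣ X ∣ → BehrendSet (suc (suc k)) X →
    ∀ (net : Network a (BK (suc (suc k)) n X)) →
    Pr≥2/3 algorithm net (λ ω → ∃ λ v → FindsCopyAndRejects algorithm net ω v)
  findsCopy n _ 17≤n X bound behrend net = Pr≥2/3-certain algorithm net finds
    where
    x : Fin n
    x = proj₁ (behrendBound⇒Nonempty n 17≤n X bound)

    -- `x` serves both as label and as base index; its planted clique supplies the first edge.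
    v : Fin (suc (suc k) * n)
    v = cliqueVertex (suc (suc k)) n x x zero

    p : Fin (Network.deg net v)
    p = proj₁ (Network.port net (x , x , proj₂ (behrendBound⇒Nonempty n 17≤n X bound) ,
                                 zero , suc zero , (λ ()) , refl , refl))

    finds : ∀ ω → ∃ λ v → FindsCopyAndRejects algorithm net ω v
    finds ω = v , Run.Rejects⇒finds net ω v (Run.rejects net v p (unique-clique-through-edge behrend) ω)
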